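{- $C_3(n,\mathrm{TC}_e)=n^{o(1)}$ as $n\to\infty$, where $\mathrm{TC}_e$ is the $3$-graph with vertex set $\{a,b,c,d,e\}$ and edges $\{a,b,d\},\{b,c,d\},\{c,d,e\},\{a,c,d\}$.
   Context: An $r$-graph is an $r$-uniform hypergraph; $K_n^{(r)}$ is the complete $r$-graph on $n$ vertices. For an $r$-graph $H$, an $(n,r,H)$-local coloring with $k$ colors is a family of $n$ edge-colorings $f_v:E(K_n^{(r)})\to[k]$, one for each vertex $v$ of $K_n^{(r)}$, such that for every copy $T$ of $H$ in $K_n^{(r)}$ there is a vertex $u\in V(T)$ for which $f_u$ is rainbow on $T$ (no two edges of $T$ get the same color under $f_u$). $C_r(n,H)$ is the minimum such $k$. -}

module Defs where

open import Data.Nat using (ℕ; _≤_; _^_)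
open import Data.Fin using (Fin; zero; suc)
open import Data.Product using (Σ; ∃; _×_; _,_)
open import Relation.Binary.PropositionalEquality using (_≡_; _≢_)
open import Function.Definitions using (Injective)

-- An edge-colouring of K_n^(3) with k colours, represented as a function
-- on ordered triples that is invariant under permuting its arguments
-- (transpositions of the first two and of the last two generate S_3),
-- i.e. a function on 3-element subsets {x,y,z}.  Values on triples with
-- repeated entries are irrelevant (never used).
record EdgeColouring (n k : ℕ) : Set where
  field
    col   : Fin n → Fin n → Fin n → Fin k
    sym₁₂ : ∀ x y z → col x y z ≡ col y x z
    sym₂₃ : ∀ x y z → col x y z ≡ col x z y
open EdgeColouring public

record Graph3 : Set where
  field
    nV    : ℕ
    nE    : ℕ
    edge  : Fin nE → Fin nV × Fin nV × Fin nV
open Graph3 public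

TCe : Graph3
TCe = record { nV = 5 ; nE = 4 ; edge = es }
  where
  a b c d e : Fin 5
  a = zero
  b = suc zero
  c = suc (suc zero)
  d = suc (suc (suc zero))
  e = suc (suc (suc (suc zero)))
  es : Fin 4 → Fin 5 × Fin 5 × Fin 5
  es zero = a , b , d
  es (suc zero) = b , c , d
  es (suc (suc zero)) = c , d , e
  es (suc (suc (suc zero))) = a , c , d

edgeColour : ∀ {n k} (H : Graph3) → (Fin (nV H) → Fin n) → EdgeColouring n k
           → Fin (nE H) → Fin k
edgeColour H φ f i with edge H i
... | (x , y , z) = col f (φ x) (φ y) (φ z)

Rainbow : ∀ {n k} (H : Graph3) → (Fin (nV H) → Fin n) → EdgeColouring n k → Set
Rainbow H φ f = ∀ i j → i ≢ j → edgeColour H φ f i ≢ edgeColour H φ f j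

-- An (n,3,H)-local colouring with k colours.  Copies of H in K_n^(3) are
-- exactly the images of injective maps V(H) → [n] (each copy arises from
-- possibly several such maps, which is harmless).
LocalColouring : (n : ℕ) (H : Graph3) (k : ℕ) → Set
LocalColouring n H k =
  Σ (Fin n → EdgeColouring n k) λ f →
    ∀ (φ : Fin (nV H) → Fin n) → Injective _≡_ _≡_ φ →
      ∃ λ (u : Fin (nV H)) → Rainbow H φ (f (φ u))

-- C_3(n,H) ≤ n^(1/m)  ⟺  there is a local colouring with k colours, k^m ≤ n.
-- (C_3 is the minimum k, and a colouring with k colours is one with any k' ≥ k.)
C₃≤root : (n : ℕ) (H : Graph3) (m : ℕ) → Set
C₃≤root n H m = ∃ λ (k : ℕ) → (k ^ m ≤ n) × LocalColouring n H k

{-# OPTIONS --safe #-}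
module Submission where

-- Give every vertex v a word D v of t = s² digits over a small alphabet of size
-- about n^(1/t), determining v, and a word E v of length t over an alphabet of
-- size about n^(1/s), such that distinct words E u, E v agree in at most s places.
-- Let δ(x,y) be a place where D x and D y differ.  Besides some bookkeeping,
-- f_u records for x, w in the edge (or equal to u) the place δ(x,w), the letter of
-- D x at δ(w,x), the letter of E x at δ(u,w), and the restriction of D x to the
-- places where E u and E w agree; this takes n^O(1/s) colours.  If f_u gives edges
-- r∪A and s∪A the same colour, then r and s look alike from u and each w ∈ A:
--  * this is ultrametric: if r, s look alike from w then w, r do not from s;
--  * it cannot be mutual: if u, w look alike from r, s then E u, E w agree at δ(r,s),
--    so if also r, s look alike from u, w, then D r, D s agree at δ(r,s).
-- For a copy of TC_e, if none of f_a, f_b, f_e were rainbow, then, choosing one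
-- collision for each of these three views, two of them violate one of the rules.

open import Defs
open import Data.Nat using (ℕ; zero; suc; _+_; _*_; _^_; _≤_; _<_; _≥_; z≤n; s≤s; NonZero; >-nonZero)
open import Data.Nat.Properties
open import Data.Nat.DivMod using (_/_; _%_; m%n<n; m≡m%n+[m/n]*n; m<n*o⇒m/o<n; [m+kn]%n≡m%n; m<n⇒m%n≡m)
open import Data.Nat.Solver using () renaming (module +-*-Solver to ℕ-Solver)
open import Data.Integer as ℤ using (ℤ; 0ℤ)
import Data.Integer.Properties as ℤ
open import Data.Integer.Solver using () renaming (module +-*-Solver to ℤ-Solver)
open import Data.Fin as Fin using (Fin; zero; suc; toℕ; fromℕ<)
open import Data.Fin.Patterns using (0F; 1F; 2F; 3F; 4F; 5F)
import Data.Fin.Properties as Fin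
open import Data.Vec using (Vec; []; _∷_; lookup)
open import Data.List using (List; []; _∷_; length; map; filter; allFin; cartesianProduct)
open import Data.List.Properties using (length-tabulate; length-map)
open import Data.List.Relation.Unary.All as All using (All; []; _∷_)
import Data.List.Relation.Unary.All.Properties as All
open import Data.List.Relation.Unary.AllPairs using ([]; _∷_)
open import Data.List.Relation.Unary.Any using (here; there)
open import Data.List.Relation.Unary.Unique.Propositional using (Unique)
import Data.List.Relation.Unary.Unique.Propositional.Properties as Unique
open import Data.List.Relation.Unary.Sorted.TotalOrder.Properties using (↗↭↗⇒≋)
open import Data.List.Relation.Binary.Pointwise using (Pointwise-≡⇒≡)
open import Data.List.Relation.Binary.Permutation.Propositional using (_↭_; ↭-sym; ↭-trans; ↭⇒↭ₛ; swap; prep; ↭-refl)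
open import Data.List.Relation.Binary.Permutation.Propositional.Properties using (∈-resp-↭; ↭-length)
open import Data.List.Membership.Propositional using (_∈_; _∉_)
open import Data.List.Membership.Propositional.Properties using (∈-allFin; ∈-cartesianProduct⁺; ∈-filter⁺; ∈-filter⁻; ∈-map⁺; ∈-map⁻)
import Data.List.Membership.DecPropositional as DecMembership
import Data.List.Sort as Sort
open import Data.Product using (∃; _×_; _,_; proj₁; proj₂)
open import Data.Sum using (_⊎_; inj₁; inj₂)
open import Data.Empty using (⊥; ⊥-elim)
open import Function using (_∘_)
open import Function.Definitions using (Injective)
open import Relation.Nullary using (Dec; yes; no; ¬_; ¬?; _×-dec_; _⊎-dec_)
open import Relation.Nullary.Decidable using (True; toWitness; decidable-stable)
open import Relation.Unary using (Decidable)
open import Relation.Binary.PropositionalEquality using (_≡_; _≢_; refl; sym; trans; cong; cong₂; subst; module ≡-Reasoning)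

-- Packing bounded numbers into one colour

module _ {I : Set} (b : ℕ) where

  -- Positional notation in base `b`, the first index giving the least significant digit.
  pack : (I → ℕ) → List I → ℕ
  pack f []       = 0
  pack f (i ∷ is) = f i + pack f is * b

  pack-< : ∀ f is → (∀ i → f i < b) → pack f is < b ^ length is
  pack-< f []       f<b = s≤s z≤n
  pack-< f (i ∷ is) f<b = begin
    suc (f i) + pack f is * b  ≤⟨ +-monoˡ-≤ _ (f<b i) ⟩
    suc (pack f is) * b        ≤⟨ *-monoˡ-≤ b (pack-< f is f<b) ⟩
    b ^ length is * b          ≡⟨ *-comm (b ^ length is) b ⟩
    b * b ^ length is          ∎
    where open ≤-Reasoning

  pack-injective : ∀ f g is → (∀ i → f i < b) → (∀ i → g i < b) →
                   pack f is ≡ pack g is → All (λ i → f i ≡ g i) is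
  pack-injective f g []       f<b g<b eq = []
  pack-injective f g (i ∷ is) f<b g<b eq = head ∷ pack-injective f g is f<b g<b tail
    where
    instance
      b≢0 : NonZero b
      b≢0 = >-nonZero (≤-<-trans z≤n (f<b i))
    open ≡-Reasoning
    head : f i ≡ g i
    head = begin
      f i                      ≡⟨ m<n⇒m%n≡m (f<b i) ⟨
      f i % b                  ≡⟨ [m+kn]%n≡m%n (f i) (pack f is) b ⟨
      pack f (i ∷ is) % b      ≡⟨ cong (_% b) eq ⟩
      pack g (i ∷ is) % b      ≡⟨ [m+kn]%n≡m%n (g i) (pack g is) b ⟩
      g i % b                  ≡⟨ m<n⇒m%n≡m (g<b i) ⟩
      g i                      ∎
    tail : pack f is ≡ pack g is
    tail = *-cancelʳ-≡ _ _ b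
      (+-cancelˡ-≡ (f i) _ _ (trans eq (cong (_+ pack g is * b) (sym head))))

  opaque

    packFin : (f : I → ℕ) (is : List I) → (∀ i → f i < b) → Fin (b ^ length is)
    packFin f is f<b = fromℕ< (pack-< f is f<b)

    packFin-injective : (f g : I → ℕ) (is : List I) (f<b : ∀ i → f i < b) (g<b : ∀ i → g i < b) →
                        packFin f is f<b ≡ packFin g is g<b → All (λ i → f i ≡ g i) is
    packFin-injective f g is f<b g<b eq = pack-injective f g is f<b g<b
      (Fin.fromℕ<-injective _ _ (pack-< f is f<b) (pack-< g is g<b) eq)

-- Integer polynomials and their roots

evalℤ : ∀ {s} → Vec ℤ s → ℤ → ℤ
evalℤ []       x = 0ℤ
evalℤ (c ∷ cs) x = c ℤ.+ x ℤ.* evalℤ cs x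

-- Synthetic division by X - r: the coefficients are the Horner values at `r` of the tails of the
-- polynomial; the remainder, its value at `r`, is dropped.
quotient : ∀ {s} → ℤ → Vec ℤ (suc s) → Vec ℤ s
quotient r (c ∷ [])          = []
quotient r (c ∷ cs@(_ ∷ _)) = evalℤ cs r ∷ quotient r cs

factor : ∀ {s} r (cs : Vec ℤ (suc s)) x →
         evalℤ cs x ≡ evalℤ cs r ℤ.+ (x ℤ.- r) ℤ.* evalℤ (quotient r cs) x
factor r (c ∷ []) x =
  solve 3 (λ c x r → c :+ x :* con 0ℤ := (c :+ r :* con 0ℤ) :+ (x :- r) :* con 0ℤ) refl c x r
  where open ℤ-Solver
factor r (c ∷ cs@(_ ∷ _)) x =
  trans (cong (λ y → c ℤ.+ x ℤ.* y) (factor r cs x))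
    (solve 5 (λ c x r y q → c :+ x :* (y :+ (x :- r) :* q) :=
                            (c :+ r :* y) :+ (x :- r) :* (y :+ x :* q))
       refl c x r (evalℤ cs r) (evalℤ (quotient r cs) x))
  where open ℤ-Solver

-- Dividing out one root leaves a shorter vector. Since ℤ has no zero divisors, the remaining roots,
-- being distinct from the first, pass to the quotient.
many-roots⇒zero : ∀ {s} (cs : Vec ℤ s) rs → Unique rs → All (λ r → evalℤ cs r ≡ 0ℤ) rs →
                  s ≤ length rs → ∀ x → evalℤ cs x ≡ 0ℤ
many-roots⇒zero []          rs       _          _            _       x = refl
many-roots⇒zero cs@(_ ∷ _) (r ∷ rs) (r≢ ∷ rs!) (root ∷ roots) (s≤s le) x = begin
  evalℤ cs x                                            ≡⟨ factor r cs x ⟩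
  evalℤ cs r ℤ.+ (x ℤ.- r) ℤ.* evalℤ (quotient r cs) x  ≡⟨ cong₂ (λ y z → y ℤ.+ (x ℤ.- r) ℤ.* z) root (quotient≡0 x) ⟩
  0ℤ ℤ.+ (x ℤ.- r) ℤ.* 0ℤ                               ≡⟨ ℤ.+-identityˡ _ ⟩
  (x ℤ.- r) ℤ.* 0ℤ                                      ≡⟨ ℤ.*-zeroʳ (x ℤ.- r) ⟩
  0ℤ                                                    ∎
  where
  open ≡-Reasoning
  root-of-quotient : ∀ {y} → r ≢ y × evalℤ cs y ≡ 0ℤ → evalℤ (quotient r cs) y ≡ 0ℤ
  root-of-quotient {y} (r≢y , cs[y]≡0)
    with ℤ.i*j≡0⇒i≡0∨j≡0 (y ℤ.- r) product≡0
    where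
    product≡0 : (y ℤ.- r) ℤ.* evalℤ (quotient r cs) y ≡ 0ℤ
    product≡0 = begin
      (y ℤ.- r) ℤ.* evalℤ (quotient r cs) y                 ≡⟨ ℤ.+-identityˡ _ ⟨
      0ℤ ℤ.+ (y ℤ.- r) ℤ.* evalℤ (quotient r cs) y          ≡⟨ cong (λ z → z ℤ.+ (y ℤ.- r) ℤ.* evalℤ (quotient r cs) y) root ⟨
      evalℤ cs r ℤ.+ (y ℤ.- r) ℤ.* evalℤ (quotient r cs) y  ≡⟨ factor r cs y ⟨
      evalℤ cs y                                            ≡⟨ cs[y]≡0 ⟩
      0ℤ                                                    ∎
  ... | inj₁ y-r≡0 = ⊥-elim (r≢y (sym (ℤ.i-j≡0⇒i≡j y r y-r≡0)))
  ... | inj₂ eq    = eq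
  quotient≡0 : ∀ y → evalℤ (quotient r cs) y ≡ 0ℤ
  quotient≡0 = many-roots⇒zero (quotient r cs) rs rs! (All.zipWith root-of-quotient (r≢ , roots)) le

-- Natural-number polynomials that agree often

eval : ∀ {s} → Vec ℕ s → ℕ → ℕ
eval []       x = 0
eval (c ∷ cs) x = c + x * eval cs x

eval-< : ∀ {s b x t} (cs : Vec ℕ s) → 0 < b → (∀ i → lookup cs i < b) → x ≤ t →
         eval cs x < b * suc t ^ s
eval-< {b = b} []  0<b cs<b x≤t = ≤-trans 0<b (≤-reflexive (sym (*-identityʳ b)))
eval-< {suc s} {b} {x} {t} (c ∷ cs) 0<b cs<b x≤t = begin-strict
  c + x * eval cs x            <⟨ +-mono-<-≤ (cs<b zero) (*-mono-≤ x≤t (<⇒≤ (eval-< cs 0<b (cs<b ∘ suc) x≤t))) ⟩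
  b + t * (b * T)              ≤⟨ +-monoˡ-≤ _ (m≤m*n b T) ⟩
  b * T + t * (b * T)          ≡⟨⟩
  suc t * (b * T)              ≡⟨ *-assoc (suc t) b T ⟨
  suc t * b * T                ≡⟨ cong (_* T) (*-comm (suc t) b) ⟩
  b * suc t * T                ≡⟨ *-assoc b (suc t) T ⟩
  b * (suc t * T)              ∎
  where
  open ≤-Reasoning
  T = suc t ^ s
  instance
    T≢0 : NonZero T
    T≢0 = m^n≢0 (suc t) s

difference : ∀ {s} → Vec ℕ s → Vec ℕ s → Vec ℤ s
difference []       []       = []
difference (c ∷ cs) (d ∷ ds) = (ℤ.+ c ℤ.- ℤ.+ d) ∷ difference cs ds

evalℤ-difference : ∀ {s} (cs ds : Vec ℕ s) x →
                   evalℤ (difference cs ds) (ℤ.+ x) ≡ ℤ.+ eval cs x ℤ.- ℤ.+ eval ds x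
evalℤ-difference []       []       x = refl
evalℤ-difference (c ∷ cs) (d ∷ ds) x = begin
  (ℤ.+ c ℤ.- ℤ.+ d) ℤ.+ ℤ.+ x ℤ.* evalℤ (difference cs ds) (ℤ.+ x)
    ≡⟨ cong (λ y → (ℤ.+ c ℤ.- ℤ.+ d) ℤ.+ ℤ.+ x ℤ.* y) (evalℤ-difference cs ds x) ⟩
  (ℤ.+ c ℤ.- ℤ.+ d) ℤ.+ ℤ.+ x ℤ.* (ℤ.+ eval cs x ℤ.- ℤ.+ eval ds x)
    ≡⟨ solve 5 (λ c d x p q → (c :- d) :+ x :* (p :- q) := (c :+ x :* p) :- (d :+ x :* q))
         refl (ℤ.+ c) (ℤ.+ d) (ℤ.+ x) (ℤ.+ eval cs x) (ℤ.+ eval ds x) ⟩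
  (ℤ.+ c ℤ.+ ℤ.+ x ℤ.* ℤ.+ eval cs x) ℤ.- (ℤ.+ d ℤ.+ ℤ.+ x ℤ.* ℤ.+ eval ds x)
    ≡⟨ cong₂ ℤ._-_ (pos-eval c cs) (pos-eval d ds) ⟨
  ℤ.+ eval (c ∷ cs) x ℤ.- ℤ.+ eval (d ∷ ds) x ∎
  where
  open ≡-Reasoning
  open ℤ-Solver
  pos-eval : ∀ {s} c (cs : Vec ℕ s) → ℤ.+ eval (c ∷ cs) x ≡ ℤ.+ c ℤ.+ ℤ.+ x ℤ.* ℤ.+ eval cs x
  pos-eval c cs = cong (λ y → ℤ.+ c ℤ.+ y) (ℤ.pos-* x (eval cs x))

-- The roots of the difference are counted over ℤ. The conclusion covers points outside `xs`, such
-- as the base whose digits are the coefficients.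
agree-often⇒agree : ∀ {s} (cs ds : Vec ℕ s) xs → Unique xs →
                    All (λ x → eval cs x ≡ eval ds x) xs → s ≤ length xs →
                    ∀ x → eval cs x ≡ eval ds x
agree-often⇒agree cs ds xs xs! agree le x = ℤ.+-injective (ℤ.i-j≡0⇒i≡j _ _
  (trans (sym (evalℤ-difference cs ds x))
    (many-roots⇒zero (difference cs ds) (map ℤ.+_ xs) (Unique.map⁺ ℤ.+-injective xs!)
      (All.map⁺ (All.map root agree)) (≤-trans le (≤-reflexive (sym (length-map ℤ.+_ xs)))) (ℤ.+ x))))
  where
  root : ∀ {y} → eval cs y ≡ eval ds y → evalℤ (difference cs ds) (ℤ.+ y) ≡ 0ℤ
  root {y} eq = trans (evalℤ-difference cs ds y) (ℤ.i≡j⇒i-j≡0 (cong ℤ.+_ eq))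

-- Digits and the code

module _ (b : ℕ) .{{_ : NonZero b}} where

  digits : ∀ s → ℕ → Vec ℕ s
  digits zero    v = []
  digits (suc s) v = v % b ∷ digits s (v / b)

  digits-< : ∀ s v i → lookup (digits s v) i < b
  digits-< (suc s) v zero    = m%n<n v b
  digits-< (suc s) v (suc i) = digits-< s (v / b) i

  eval-digits : ∀ s v → v < b ^ s → eval (digits s v) b ≡ v
  eval-digits zero    zero v<    = refl
  eval-digits zero    (suc v) (s≤s ())
  eval-digits (suc s) v v< = begin
    v % b + b * eval (digits s (v / b)) b  ≡⟨ cong (λ y → v % b + b * y) (eval-digits s (v / b) v/b<) ⟩
    v % b + b * (v / b)                    ≡⟨ cong (v % b +_) (*-comm b (v / b)) ⟩
    v % b + v / b * b                      ≡⟨ m≡m%n+[m/n]*n v b ⟨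
    v                                      ∎
    where
    open ≡-Reasoning
    v/b< : v / b < b ^ s
    v/b< = m<n*o⇒m/o<n (<-≤-trans v< (≤-reflexive (*-comm b (b ^ s))))

record Code (V : Set) (t s k M : ℕ) : Set where
  field
    D      : V → Fin t → ℕ
    E      : V → Fin t → ℕ
    D<k    : ∀ v i → D v i < k
    E<M    : ∀ v i → E v i < M
    D-sep  : ∀ {u v} → u ≢ v → ∃ λ i → D u i ≢ D v i
    E-sep  : ∀ {u v} → u ≢ v → ∀ is → Unique is → All (λ i → E u i ≡ E v i) is → length is ≤ s

lookup-ext : ∀ {s} (cs ds : Vec ℕ s) → (∀ i → lookup cs i ≡ lookup ds i) → cs ≡ ds
lookup-ext []       []       eq = refl
lookup-ext (c ∷ cs) (d ∷ ds) eq = cong₂ _∷_ (eq zero) (lookup-ext cs ds (eq ∘ suc))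

-- E v is a Reed–Solomon word over the integers: the base-bᵍ digits of v are
-- the coefficients of a polynomial, evaluated at 0, …, t − 1.
digitCode : ∀ {n} (s g b : ℕ) .{{_ : NonZero b}} → n ≤ b ^ (g * s) →
            Code (Fin n) (g * s) s b (b ^ g * suc (g * s) ^ s)
digitCode {n} s g b n≤ = record
  { D      = λ v → lookup (low v)
  ; E      = λ v i → eval (high v) (toℕ i)
  ; D<k    = λ v → digits-< b (g * s) (toℕ v)
  ; E<M    = λ v i → eval-< (high v) (m^n>0 b g) (digits-< (b ^ g) s (toℕ v)) (<⇒≤ (Fin.toℕ<n i))
  ; D-sep  = λ {u} {v} u≢v → Fin.¬∀⟶∃¬ (g * s) _ (λ i → lookup (low u) i ≟ lookup (low v) i)
               (u≢v ∘ low-injective u v ∘ lookup-ext (low u) (low v))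
  ; E-sep  = λ {u} {v} → agreements u v
  }
  where
  instance
    bᵍ≢0 : NonZero (b ^ g)
    bᵍ≢0 = m^n≢0 b g
  low : Fin n → Vec ℕ (g * s)
  low v = digits b (g * s) (toℕ v)
  high : Fin n → Vec ℕ s
  high v = digits (b ^ g) s (toℕ v)
  low-injective : ∀ u v → low u ≡ low v → u ≡ v
  low-injective u v eq = Fin.toℕ-injective (begin
    toℕ u           ≡⟨ eval-digits b (g * s) (toℕ u) (<-≤-trans (Fin.toℕ<n u) n≤) ⟨
    eval (low u) b  ≡⟨ cong (λ w → eval w b) eq ⟩
    eval (low v) b  ≡⟨ eval-digits b (g * s) (toℕ v) (<-≤-trans (Fin.toℕ<n v) n≤) ⟩
    toℕ v           ∎)
    where open ≡-Reasoning
  toℕ<bᵍˢ : ∀ v → toℕ v < (b ^ g) ^ s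
  toℕ<bᵍˢ v = <-≤-trans (Fin.toℕ<n v) (≤-trans n≤ (≤-reflexive (sym (^-*-assoc b g s))))
  agreements : ∀ u v → u ≢ v → ∀ is → Unique is →
               All (λ i → eval (high u) (toℕ i) ≡ eval (high v) (toℕ i)) is → length is ≤ s
  agreements u v u≢v is is! agree with s ≤? length is
  ... | no s≰  = <⇒≤ (≰⇒> s≰)
  -- With `s` agreements the two polynomials agree everywhere, in particular at the base `b ^ g`,
  -- where evaluating the digits gives back `u` and `v`.
  ... | yes s≤ = ⊥-elim (u≢v (Fin.toℕ-injective (begin
    toℕ u                  ≡⟨ eval-digits (b ^ g) s (toℕ u) (toℕ<bᵍˢ u) ⟨
    eval (high u) (b ^ g)  ≡⟨ agree-often⇒agree (high u) (high v) (map toℕ is)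
                                (Unique.map⁺ Fin.toℕ-injective is!) (All.map⁺ agree)
                                (≤-trans s≤ (≤-reflexive (sym (length-map toℕ is)))) (b ^ g) ⟩
    eval (high v) (b ^ g)  ≡⟨ eval-digits (b ^ g) s (toℕ v) (toℕ<bᵍˢ v) ⟩
    toℕ v                  ∎)))
    where open ≡-Reasoning

-- Lists and feature indices

length-filter-¬ : ∀ {A : Set} {P : A → Set} (P? : Decidable P) xs →
                  length xs ≡ length (filter P? xs) + length (filter (¬? ∘ P?) xs)
length-filter-¬ P? []       = refl
length-filter-¬ P? (x ∷ xs) with P? x
... | yes _ = cong suc (length-filter-¬ P? xs)
... | no  _ = trans (cong suc (length-filter-¬ P? xs)) (sym (+-suc _ _))

module _ {n : ℕ} where
  open Sort (Fin.≤-decTotalOrder n) public using (sort; sort-↭; sort-↗)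

-- A sorted list is determined by its multiset of entries. This makes the colour of an edge
-- independent of the order of its vertices.
sort-cong : ∀ {n} {xs ys : List (Fin n)} → xs ↭ ys → sort xs ≡ sort ys
sort-cong {n} {xs} {ys} xs↭ys = Pointwise-≡⇒≡ (↗↭↗⇒≋ (Fin.≤-totalOrder n) (sort-↗ xs) (sort-↗ ys)
  (↭⇒↭ₛ (↭-trans (sort-↭ xs) (↭-trans xs↭ys (↭-sym (sort-↭ ys))))))

-- The default d is returned past the end of the list.
at : ∀ {A : Set} {m} → A → List A → Fin m → A
at d []       i       = d
at d (x ∷ xs) zero    = x
at d (x ∷ xs) (suc i) = at d xs i

at-∈ : ∀ {A : Set} {m} d (xs : List A) (i : Fin m) → length xs ≡ m → at d xs i ∈ xs
at-∈ d (x ∷ xs) zero    eq = here refl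
at-∈ d (x ∷ xs) (suc i) refl = there (at-∈ d xs i refl)

∈-at : ∀ {A : Set} {m} d {x : A} {xs} → x ∈ xs → length xs ≡ m → ∃ λ (i : Fin m) → at d xs i ≡ x
∈-at d (here refl) refl = zero , refl
∈-at d (there x∈)  refl = let i , eq = ∈-at d x∈ refl in suc i , eq

-- Two positions in a 4-tuple, which holds the owner of the view and then the three vertices of the
-- edge, and one of six kinds of feature.
Index : Set
Index = Fin 4 × Fin 4 × Fin 6

opaque

  indices : List Index
  indices = cartesianProduct (allFin 4) (cartesianProduct (allFin 4) (allFin 6))

  ∈-indices : ∀ i → i ∈ indices
  ∈-indices (p , q , f) = ∈-cartesianProduct⁺ (∈-allFin p) (∈-cartesianProduct⁺ (∈-allFin q) (∈-allFin f))

  -- Leads to `16 < s` and so to `16 * s < t`, the room needed to separate the 16 pairs of positions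
  -- in a 4-tuple.
  4<length-indices : 4 < length indices
  4<length-indices = s≤s (s≤s (s≤s (s≤s (s≤s z≤n))))

-- The colouring

module Colouring {n t s k M : ℕ} (code : Code (Fin n) t s k M)
                 (16s<t : 16 * s < t) (t≤M : t ≤ M) (k≤M : k ≤ M) (kˢ≤M : k ^ s ≤ M) (1≤k : 1 ≤ k) where

  open Code code

  private
    V = Fin n

  -- Each pair of distinct vertices rules out at most `s` places, so some place in `is` survives all
  -- pairs.
  separating : (ps : List (V × V)) (is : List (Fin t)) → Unique is → length ps * s < length is →
               ∃ λ j → j ∈ is × All (λ p → proj₁ p ≢ proj₂ p → E (proj₁ p) j ≢ E (proj₂ p) j) ps
  separating []             (i ∷ is) is! lt = i , here refl , []
  separating ((u , v) ∷ ps) is is! lt with u Fin.≟ v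
  ... | yes u≡v = let j , j∈ , sep = separating ps is is! (≤-<-trans (m≤n+m _ s) lt)
                  in j , j∈ , (λ u≢v → ⊥-elim (u≢v u≡v)) ∷ sep
  ... | no u≢v  =
    let j , j∈ , sep = separating ps (filter (¬? ∘ agree?) is) (Unique.filter⁺ (¬? ∘ agree?) is!) lt′
        j∈is , Ej≢   = ∈-filter⁻ (¬? ∘ agree?) j∈
    in j , j∈is , (λ _ → Ej≢) ∷ sep
    where
    agree? : Decidable (λ i → E u i ≡ E v i)
    agree? i = E u i ≟ E v i
    few : length (filter agree? is) ≤ s
    few = E-sep u≢v _ (Unique.filter⁺ agree? is!) (All.all-filter agree? is)
    lt′ : length ps * s < length (filter (¬? ∘ agree?) is)
    lt′ = +-cancelˡ-< s _ _ (begin-strict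
      s + length ps * s                                              <⟨ lt ⟩
      length is                                                      ≡⟨ length-filter-¬ agree? is ⟩
      length (filter agree? is) + length (filter (¬? ∘ agree?) is)   ≤⟨ +-monoˡ-≤ _ few ⟩
      s + length (filter (¬? ∘ agree?) is)                           ∎)
      where open ≤-Reasoning

  -- A perfect hash for four vertices. Entries may coincide, since the owner can lie in the edge, so
  -- separation holds only up to equality of vertices.
  separating₄ : (X : Fin 4 → V) → ∃ λ j → ∀ p q → E (X p) j ≡ E (X q) j → X p ≡ X q
  separating₄ X =
    let j , _ , sep = separating (map X² pairs) (allFin t) (Unique.allFin⁺ t)
                        (≤-trans 16s<t (≤-reflexive (sym (length-tabulate {n = t} (λ i → i)))))
    in j , λ p q eq → decidable-stable (X p Fin.≟ X q) λ X≢ →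
         All.lookup sep (∈-map⁺ X² (∈-cartesianProduct⁺ (∈-allFin p) (∈-allFin q))) X≢ eq
    where
    X² : Fin 4 × Fin 4 → V × V
    X² (p , q) = X p , X q
    pairs : List (Fin 4 × Fin 4)
    pairs = cartesianProduct (allFin 4) (allFin 4)

  hash : (Fin 4 → V) → Fin t
  hash X = proj₁ (separating₄ X)

  -- δ u u is a junk value.
  δ : V → V → Fin t
  δ u v with u Fin.≟ v
  ... | yes _  = fromℕ< (≤-<-trans z≤n 16s<t)
  ... | no u≢v = proj₁ (D-sep u≢v)

  D-δ : ∀ {u v} → u ≢ v → D u (δ u v) ≢ D v (δ u v)
  D-δ {u} {v} u≢v with u Fin.≟ v
  ... | yes u≡v  = ⊥-elim (u≢v u≡v)
  ... | no  u≢v′ = proj₂ (D-sep u≢v′)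

  -- Empty on the diagonal, where the full agreement set would be too large.
  agreement : V → V → List (Fin t)
  agreement u v with u Fin.≟ v
  ... | yes _ = []
  ... | no _  = filter (λ i → E u i ≟ E v i) (allFin t)

  ∈-agreement : ∀ {u v i} → u ≢ v → E u i ≡ E v i → i ∈ agreement u v
  ∈-agreement {u} {v} {i} u≢v eq with u Fin.≟ v
  ... | yes u≡v = ⊥-elim (u≢v u≡v)
  ... | no  _   = ∈-filter⁺ (λ i → E u i ≟ E v i) (∈-allFin i) eq

  length-agreement : ∀ u v → length (agreement u v) ≤ s
  length-agreement u v with u Fin.≟ v
  ... | yes _   = z≤n
  ... | no  u≢v = E-sep u≢v _ (Unique.filter⁺ agree? (Unique.allFin⁺ t)) (All.all-filter agree? (allFin t))
    where
    agree? : Decidable (λ i → E u i ≡ E v i)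
    agree? i = E u i ≟ E v i

  -- Kinds `0F` and `1F` identify vertices across two edges; the others are the data that make
  -- vertices look alike. `X zero` is the owner. Kind `5F` packs at most `s` letters, whence the
  -- bound `k ^ s`.
  feature : (Fin 4 → V) → Index → ℕ
  feature X (p , q , 0F) = toℕ (hash X)
  feature X (p , q , 1F) = E (X p) (hash X)
  feature X (p , q , 2F) = toℕ (δ (X p) (X q))
  feature X (p , q , 3F) = D (X p) (δ (X q) (X p))
  feature X (p , q , 4F) = E (X p) (δ (X zero) (X q))
  feature X (p , q , 5F) = pack k (D (X p)) (agreement (X zero) (X q))

  feature-< : ∀ X i → feature X i < M
  feature-< X (p , q , 0F) = <-≤-trans (Fin.toℕ<n _) t≤M
  feature-< X (p , q , 1F) = E<M _ _
  feature-< X (p , q , 2F) = <-≤-trans (Fin.toℕ<n _) t≤M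
  feature-< X (p , q , 3F) = <-≤-trans (D<k _ _) k≤M
  feature-< X (p , q , 4F) = E<M _ _
  feature-< X (p , q , 5F) = <-≤-trans (pack-< k _ (agreement (X zero) (X q)) (D<k _))
    (≤-trans (^-monoʳ-≤ k (length-agreement (X zero) (X q))) kˢ≤M)
    where
    instance
      k≢0 : NonZero k
      k≢0 = >-nonZero 1≤k

  tuple : V → List V → Fin 4 → V
  tuple u xs zero    = u
  tuple u xs (suc p) = at u xs p

  colour : V → List V → Fin (M ^ length indices)
  colour u xs = packFin M (feature (tuple u xs)) indices (feature-< (tuple u xs))

  colour⇒feature : ∀ u xs ys → colour u xs ≡ colour u ys →
                   ∀ i → feature (tuple u xs) i ≡ feature (tuple u ys) i
  colour⇒feature u xs ys eq i = All.lookup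
    (packFin-injective M (feature (tuple u xs)) (feature (tuple u ys)) indices
      (feature-< (tuple u xs)) (feature-< (tuple u ys)) eq)
    (∈-indices i)

  colouring : V → EdgeColouring n (M ^ length indices)
  colouring u = record
    { col   = λ x y z → colour u (sort (x ∷ y ∷ z ∷ []))
    ; sym₁₂ = λ x y z → cong (colour u) (sort-cong (swap x y ↭-refl))
    ; sym₂₃ = λ x y z → cong (colour u) (sort-cong (prep x (swap y z ↭-refl)))
    }

  -- Two vertices that look alike from a third

  record Indist (u w r s : V) : Set where
    field
      δʳ : δ r w ≡ δ s w
      δˡ : δ w r ≡ δ w s
      Dδ : D r (δ w r) ≡ D s (δ w s)
      Eδ : E r (δ u w) ≡ E s (δ u w)
      Dᴱ : ∀ {i} → u ≢ w → E u i ≡ E w i → D r i ≡ D s i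
  open Indist

  Indist-sym : ∀ {u w r s} → Indist u w r s → Indist u w s r
  Indist-sym I = record
    { δʳ = sym (δʳ I) ; δˡ = sym (δˡ I) ; Dδ = sym (Dδ I) ; Eδ = sym (Eδ I)
    ; Dᴱ = λ u≢w eq → sym (Dᴱ I u≢w eq) }

  -- The places `δ w r`, `δ w s` and `δ r s` all coincide, and `D r` and `D s` agree there. The
  -- owners of the two views may differ.
  triangle : ∀ {u u′ w r s} → r ≢ s → Indist u w r s → Indist u′ s w r → ⊥
  triangle {w = w} {r} {s} r≢s I I′ = D-δ r≢s (begin
    D r (δ r s)  ≡⟨ cong (D r) (sym δwr≡δrs) ⟩
    D r (δ w r)  ≡⟨ Dδ I ⟩
    D s (δ w s)  ≡⟨ cong (D s) (δʳ I′) ⟩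
    D s (δ r s)  ∎)
    where
    open ≡-Reasoning
    δwr≡δrs : δ w r ≡ δ r s
    δwr≡δrs = trans (δˡ I) (δʳ I′)

  -- `I′` puts `δ r s` among the places where `E u` and `E w` agree, and on those `I` equates `D r`
  -- with `D s`.
  exchange : ∀ {u w r s} → u ≢ w → r ≢ s → Indist u w r s → Indist r s u w → ⊥
  exchange u≢w r≢s I I′ = D-δ r≢s (Dᴱ I u≢w (Eδ I′))

  -- Consequences of one collision

  module Collision (u : V) (xs ys : List V) (collide : colour u xs ≡ colour u ys) where

    private
      X = tuple u xs
      Y = tuple u ys
      same = colour⇒feature u xs ys collide
      j = hash X

    separates-X : ∀ p q → E (X p) j ≡ E (X q) j → X p ≡ X q
    separates-X = proj₂ (separating₄ X)

    -- The hash place is itself a recorded feature, so the place chosen for `Y` is also `j`.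
    separates-Y : ∀ p q → E (Y p) j ≡ E (Y q) j → Y p ≡ Y q
    separates-Y = subst (λ i → ∀ p q → E (Y p) i ≡ E (Y q) i → Y p ≡ Y q)
      (sym (Fin.toℕ-injective (same (zero , zero , 0F)))) (proj₂ (separating₄ Y))

    same-E : ∀ p → E (X p) j ≡ E (Y p) j
    same-E p = trans (same (p , zero , 1F))
      (cong (E (Y p)) (sym (Fin.toℕ-injective (same (zero , zero , 0F)))))

    -- The letters of E at the common place j name the vertices, so a vertex of
    -- both tuples occurs at a common position, although the two edges are sorted
    -- independently.
    Aligned : V → V → Set
    Aligned x y = ∃ λ p → X p ≡ x × Y p ≡ y

    -- At `j`, `X q` has the letter of `Y q`, which is `X p`; separation then forces `X q` to be
    -- `X p`, so `q` is a common position.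
    aligned-refl : ∀ p q → X p ≡ Y q → Aligned (X p) (X p)
    aligned-refl p q eq = q , separates-X q p (trans (same-E q) (cong (λ v → E v j) (sym eq))) , sym eq

    aligned-injective : ∀ {x x′ y} → Aligned x y → Aligned x′ y → x ≡ x′
    aligned-injective (p , refl , refl) (q , refl , eq) =
      separates-X p q (trans (same-E p) (trans (cong (λ v → E v j) (sym eq)) (sym (same-E q))))

    -- The owner stands at position zero of both tuples. If its letter recurs in `X` it recurs at
    -- the same position in `Y`, so the colour reveals whether the owner lies in the edge.
    owner∈ : length ys ≡ 3 → ∀ p → X (suc p) ≡ u → u ∈ ys
    owner∈ len p eq = subst (_∈ ys)
      (separates-Y (suc p) zero (trans (sym (same-E (suc p))) (cong (λ v → E v j) eq)))
      (at-∈ u ys p len)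

    aligned⇒indist : ∀ {w r s} → Aligned w w → Aligned r s → Indist u w r s
    aligned⇒indist (q , refl , eq) (p , refl , refl) = record
      { δʳ = trans (Fin.toℕ-injective (same (p , q , 2F))) (cong (δ (Y p)) eq)
      ; δˡ = trans (Fin.toℕ-injective (same (q , p , 2F))) (cong (λ v → δ v (Y p)) eq)
      ; Dδ = trans (same (p , q , 3F)) (cong (λ v → D (Y p) (δ v (Y p))) eq)
      ; Eδ = trans (same (p , q , 4F)) (cong (λ v → E (Y p) (δ u v)) eq)
      ; Dᴱ = λ u≢w Eu≡Ew → All.lookup
          (pack-injective k (D (X p)) (D (Y p)) (agreement u (X q)) (D<k _) (D<k _)
            (trans (same (p , q , 5F)) (cong (λ v → pack k (D (Y p)) (agreement u v)) eq)))
          (∈-agreement u≢w Eu≡Ew)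
      }

  -- Collisions within one copy of the 3-graph

  module Copy (φ : Fin 5 → V) (φ-injective : Injective _≡_ _≡_ φ) where

    open DecMembership (Fin._≟_ {5}) using (_∈?_)

    edgeOf : List (Fin 5) → List V
    edgeOf S = sort (map φ S)

    ∈-edgeOf : ∀ {S i} → i ∈ S → φ i ∈ edgeOf S
    ∈-edgeOf i∈S = ∈-resp-↭ (↭-sym (sort-↭ _)) (∈-map⁺ φ i∈S)

    edgeOf-∈ : ∀ {S v} → v ∈ edgeOf S → ∃ λ i → i ∈ S × v ≡ φ i
    edgeOf-∈ v∈ = ∈-map⁻ φ (∈-resp-↭ (sort-↭ _) v∈)

    length-edgeOf : ∀ S → length (edgeOf S) ≡ length S
    length-edgeOf S = trans (↭-length (sort-↭ (map φ S))) (length-map φ S)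

    owner-detected : ∀ u S T → length S ≡ 3 → length T ≡ 3 → u ∈ S → u ∉ T →
                     colour (φ u) (edgeOf S) ≢ colour (φ u) (edgeOf T)
    owner-detected u S T |S| |T| u∈S u∉T collide =
      let open Collision (φ u) (edgeOf S) (edgeOf T) collide
          p , Xp≡u      = ∈-at (φ u) (∈-edgeOf u∈S) (trans (length-edgeOf S) |S|)
          i , i∈T , u≡i = edgeOf-∈ (owner∈ (trans (length-edgeOf T) |T|) p Xp≡u)
      in u∉T (subst (_∈ T) (sym (φ-injective u≡i)) i∈T)

    Seen : Fin 5 → List (Fin 5) → List (Fin 5) → Fin 5 → Set
    Seen u S T w = w ≡ u ⊎ w ∈ S × w ∈ T

    Swap : Fin 5 → List (Fin 5) → List (Fin 5) → Fin 5 → Fin 5 → Set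
    Swap u S T r s = length S ≡ 3 × length T ≡ 3 × r ∈ S × ¬ Seen u S T r × All (λ i → i ≡ s ⊎ Seen u S T i) T

    -- Seen vertices are aligned with themselves, and alignment is injective. The unseen `r` must
    -- therefore be aligned with an unseen vertex of `T`, and only `s` is available.
    swap⇒indist : ∀ {u S T r s} → Swap u S T r s → colour (φ u) (edgeOf S) ≡ colour (φ u) (edgeOf T) →
                  ∀ {w} → Seen u S T w → Indist (φ u) (φ w) (φ r) (φ s)
    swap⇒indist {u} {S} {T} {r} {s} (|S| , |T| , r∈S , r-unseen , T⊆) collide seen-w =
      aligned⇒indist (seen⇒aligned seen-w) r-aligned
      where
      open Collision (φ u) (edgeOf S) (edgeOf T) collide
      seen⇒aligned : ∀ {i} → Seen u S T i → Aligned (φ i) (φ i)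
      seen⇒aligned (inj₁ refl) = zero , refl , refl
      seen⇒aligned {i} (inj₂ (i∈S , i∈T)) =
        let p , Xp≡i = ∈-at (φ u) (∈-edgeOf i∈S) (trans (length-edgeOf S) |S|)
            q , Yq≡i = ∈-at (φ u) (∈-edgeOf i∈T) (trans (length-edgeOf T) |T|)
        in subst (λ v → Aligned v v) Xp≡i (aligned-refl (suc p) (suc q) (trans Xp≡i (sym Yq≡i)))
      r-aligned : Aligned (φ r) (φ s)
      r-aligned with ∈-at (φ u) (∈-edgeOf r∈S) (trans (length-edgeOf S) |S|)
      ... | p , Xp≡r with edgeOf-∈ (at-∈ (φ u) (edgeOf T) p (trans (length-edgeOf T) |T|))
      ... | i , i∈T , Yp≡i with All.lookup T⊆ i∈T
      ... | inj₁ refl   = suc p , Xp≡r , Yp≡i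
      ... | inj₂ seen-i = ⊥-elim (r-unseen (subst (Seen u S T)
              (φ-injective (aligned-injective (seen⇒aligned seen-i) (suc p , Xp≡r , Yp≡i))) seen-i))

    -- With only five abstract vertices, the membership conditions in the case analysis below are
    -- decided by evaluation.
    seen? : ∀ u S T w → Dec (Seen u S T w)
    seen? u S T w = (w Fin.≟ u) ⊎-dec ((w ∈? S) ×-dec (w ∈? T))

    swap? : ∀ u S T r s → Dec (Swap u S T r s)
    swap? u S T r s = (length S ≟ 3) ×-dec (length T ≟ 3) ×-dec (r ∈? S) ×-dec ¬? (seen? u S T r)
      ×-dec All.all? (λ i → (i Fin.≟ s) ⊎-dec seen? u S T i) T

    private
      a b c d e : Fin 5
      a = 0F
      b = 1F
      c = 2F
      d = 3F
      e = 4F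
      abd bcd cde acd : List (Fin 5)
      abd = a ∷ b ∷ d ∷ []
      bcd = b ∷ c ∷ d ∷ []
      cde = c ∷ d ∷ e ∷ []
      acd = a ∷ c ∷ d ∷ []

    Collide : Fin 5 → List (Fin 5) → List (Fin 5) → Set
    Collide u S T = colour (φ u) (edgeOf S) ≡ colour (φ u) (edgeOf T)

    collide? : ∀ u S T → Dec (Collide u S T)
    collide? u S T = colour (φ u) (edgeOf S) Fin.≟ colour (φ u) (edgeOf T)

    detected : ∀ u x y z x′ y′ z′ {_ : True (u ∈? (x ∷ y ∷ z ∷ []))} {_ : True (¬? (u ∈? (x′ ∷ y′ ∷ z′ ∷ [])))} →
               ¬ Collide u (x ∷ y ∷ z ∷ []) (x′ ∷ y′ ∷ z′ ∷ [])
    detected u x y z x′ y′ z′ {u∈} {u∉} = owner-detected u _ _ refl refl (toWitness u∈) (toWitness u∉)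

    alike : ∀ {u S T} → Collide u S T → ∀ w r s {_ : True (swap? u S T r s)} {_ : True (seen? u S T w)} →
            Indist (φ u) (φ w) (φ r) (φ s)
    alike collide w r s {ok} {seen} = swap⇒indist (toWitness ok) collide (toWitness seen)

    distinct : ∀ i j {_ : True (¬? (i Fin.≟ j))} → φ i ≢ φ j
    distinct i j {i≢j} = toWitness i≢j ∘ φ-injective

    RainbowAt : Fin 5 → Set
    RainbowAt u = Rainbow TCe φ (colouring (φ u))

    rainbow : ∀ u → ¬ Collide u abd bcd → ¬ Collide u abd cde → ¬ Collide u abd acd →
              ¬ Collide u bcd cde → ¬ Collide u bcd acd → ¬ Collide u cde acd → RainbowAt u
    rainbow u n₀₁ n₀₂ n₀₃ n₁₂ n₁₃ n₂₃ = λ where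
      0F 0F 0≢0 → ⊥-elim (0≢0 refl)
      0F 1F _   → n₀₁
      0F 2F _   → n₀₂
      0F 3F _   → n₀₃
      1F 0F _   → n₀₁ ∘ sym
      1F 1F 1≢1 → ⊥-elim (1≢1 refl)
      1F 2F _   → n₁₂
      1F 3F _   → n₁₃
      2F 0F _   → n₀₂ ∘ sym
      2F 1F _   → n₁₂ ∘ sym
      2F 2F 2≢2 → ⊥-elim (2≢2 refl)
      2F 3F _   → n₂₃
      3F 0F _   → n₀₃ ∘ sym
      3F 1F _   → n₁₃ ∘ sym
      3F 2F _   → n₂₃ ∘ sym
      3F 3F 3≢3 → ⊥-elim (3≢3 refl)

    -- Two edges can collide only if both contain the owner or both avoid it. The four edges split
    -- 2+2 for `a` and for `b`, leaving two possible collisions each, and 1+3 for `e`, leaving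
    -- three.
    view-a : RainbowAt a ⊎ Collide a abd acd ⊎ Collide a bcd cde
    view-a with collide? a abd acd | collide? a bcd cde
    ... | yes eq | _      = inj₂ (inj₁ eq)
    ... | no _   | yes eq = inj₂ (inj₂ eq)
    ... | no n₀₃ | no n₁₂ = inj₁ (rainbow a (detected a a b d b c d) (detected a a b d c d e) n₀₃
                                    n₁₂ (detected a a c d b c d ∘ sym) (detected a a c d c d e ∘ sym))

    view-b : RainbowAt b ⊎ Collide b abd bcd ⊎ Collide b acd cde
    view-b with collide? b abd bcd | collide? b acd cde
    ... | yes eq | _      = inj₂ (inj₁ eq)
    ... | no _   | yes eq = inj₂ (inj₂ eq)
    ... | no n₀₁ | no n₃₂ = inj₁ (rainbow b n₀₁ (detected b a b d c d e) (detected b a b d a c d)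
                                    (detected b b c d c d e) (detected b b c d a c d) (n₃₂ ∘ sym))

    view-e : RainbowAt e ⊎ Collide e abd bcd ⊎ Collide e abd acd ⊎ Collide e acd bcd
    view-e with collide? e abd bcd | collide? e abd acd | collide? e acd bcd
    ... | yes eq | _      | _      = inj₂ (inj₁ eq)
    ... | no _   | yes eq | _      = inj₂ (inj₂ (inj₁ eq))
    ... | no _   | no _   | yes eq = inj₂ (inj₂ (inj₂ eq))
    ... | no n₀₁ | no n₀₃ | no n₃₁ = inj₁ (rainbow e n₀₁ (detected e c d e a b d ∘ sym) n₀₃
                                             (detected e c d e b c d ∘ sym) (n₃₁ ∘ sym) (detected e c d e a c d))

    some-view-rainbow : ∃ RainbowAt
    some-view-rainbow with view-a | view-b | view-e
    ... | inj₁ ok | _ | _ = a , ok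
    ... | inj₂ _ | inj₁ ok | _ = b , ok
    ... | inj₂ _ | inj₂ _ | inj₁ ok = e , ok
    -- From `a`, `b` and `c` look alike; from `b`, `a` and `c` do. This is impossible whatever
    -- happens at `e`.
    ... | inj₂ (inj₁ a₁) | inj₂ (inj₁ b₁) | inj₂ _ =
      ⊥-elim (triangle (distinct c b) (Indist-sym (alike a₁ a b c)) (alike b₁ b a c))
    -- Otherwise `b₂` makes `a` and `e` look alike from `b`, `c`, `d`, or `a₂` makes `b` and `e`
    -- look alike from `a`, `c`, `d`. The collision at `e` confuses two of `a`, `b`, `c`: `exchange`
    -- applies if that pair is disjoint from the first, `triangle` if they share a vertex.
    ... | inj₂ _ | inj₂ (inj₂ b₂) | inj₂ (inj₁ e₁) =
      ⊥-elim (triangle (distinct a c) (alike e₁ e a c) (Indist-sym (alike b₂ c a e)))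
    ... | inj₂ _ | inj₂ (inj₂ b₂) | inj₂ (inj₂ (inj₁ e₂)) =
      ⊥-elim (exchange (distinct b c) (distinct e a) (Indist-sym (alike b₂ c a e)) (alike e₂ a b c))
    ... | inj₂ _ | inj₂ (inj₂ b₂) | inj₂ (inj₂ (inj₂ e₃)) =
      ⊥-elim (triangle (distinct a b) (alike e₃ e a b) (Indist-sym (alike b₂ b a e)))
    ... | inj₂ (inj₂ a₂) | inj₂ (inj₁ _) | inj₂ (inj₁ e₁) =
      ⊥-elim (exchange (distinct a c) (distinct e b) (Indist-sym (alike a₂ c b e)) (alike e₁ b a c))
    ... | inj₂ (inj₂ a₂) | inj₂ (inj₁ _) | inj₂ (inj₂ (inj₁ e₂)) =
      ⊥-elim (triangle (distinct b c) (alike e₂ e b c) (Indist-sym (alike a₂ c b e)))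
    ... | inj₂ (inj₂ a₂) | inj₂ (inj₁ _) | inj₂ (inj₂ (inj₂ e₃)) =
      ⊥-elim (triangle (distinct b a) (Indist-sym (alike e₃ e a b)) (Indist-sym (alike a₂ a b e)))

  localColouring : LocalColouring n TCe (M ^ length indices)
  localColouring = colouring , Copy.some-view-rainbow

-- Choice of parameters

root : ∀ t .{{_ : NonZero t}} b₀ n → b₀ ^ t ≤ n → ∃ λ b → b₀ ≤ b × b ^ t ≤ n × n < suc b ^ t
root t b₀ n b₀ᵗ≤n with m≤n⇒∃[o]m+o≡n b₀ᵗ≤n
... | o , refl = go o
  where
  go : ∀ o → ∃ λ b → b₀ ≤ b × b ^ t ≤ b₀ ^ t + o × b₀ ^ t + o < suc b ^ t
  go zero rewrite +-identityʳ (b₀ ^ t) = b₀ , ≤-refl , ≤-refl , ^-monoˡ-< t (n<1+n b₀)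
  go (suc o) rewrite +-suc (b₀ ^ t) o with go o
  ... | b , b₀≤b , bᵗ≤ , <bᵗ with suc b ^ t ≤? suc (b₀ ^ t + o)
  -- Raising the number by one raises its integer root by at most one.
  ...   | yes le = suc b , m≤n⇒m≤1+n b₀≤b , le , ≤-<-trans <bᵗ (^-monoˡ-< t (n<1+n (suc b)))
  ...   | no ≰   = b , b₀≤b , m≤n⇒m≤1+n bᵗ≤ , ≰⇒> ≰

suc≤square : ∀ b → 2 ≤ b → suc b ≤ b ^ 2
suc≤square b 2≤b = begin
  1 + b      ≤⟨ +-monoˡ-≤ b (<⇒≤ 2≤b) ⟩
  b + b      ≡⟨ cong (b +_) (+-identityʳ b) ⟨
  2 * b      ≤⟨ *-monoˡ-≤ b 2≤b ⟩
  b * b      ≡⟨ cong (b *_) (*-identityʳ b) ⟨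
  b ^ 2      ∎
  where open ≤-Reasoning

-- The exponent is at most 2(s+1)m ≤ 4sm = s². One factor 2 pays for replacing `suc b` by a power of
-- `b`, the other for s+1 ≤ 2s; hence s = 4m.
few-colours : ∀ m b n → 1 ≤ m → 2 ≤ b →
              let s = 4 * m ; t = s * s ; c = suc t ^ s in
              c ≤ suc b → b ^ t ≤ n → (suc b ^ s * c) ^ m ≤ n
few-colours m b n 1≤m 2≤b c≤ bᵗ≤n = begin
  (suc b ^ s * c) ^ m           ≤⟨ ^-monoˡ-≤ m (*-monoʳ-≤ (suc b ^ s) c≤) ⟩
  (suc b ^ s * suc b) ^ m       ≡⟨ cong (_^ m) (*-comm (suc b ^ s) (suc b)) ⟩
  (suc b ^ suc s) ^ m           ≡⟨ ^-*-assoc (suc b) (suc s) m ⟩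
  suc b ^ (suc s * m)           ≤⟨ ^-monoˡ-≤ (suc s * m) (suc≤square b 2≤b) ⟩
  (b ^ 2) ^ (suc s * m)         ≡⟨ ^-*-assoc b 2 (suc s * m) ⟩
  b ^ (2 * (suc s * m))         ≤⟨ ^-monoʳ-≤ b exponent ⟩
  b ^ (s * s)                   ≤⟨ bᵗ≤n ⟩
  n                             ∎
  where
  open ≤-Reasoning
  s = 4 * m
  c = suc (s * s) ^ s
  instance
    b≢0 : NonZero b
    b≢0 = >-nonZero (<⇒≤ 2≤b)
  exponent : 2 * (suc s * m) ≤ s * s
  exponent = begin
    2 * (suc s * m)    ≤⟨ *-monoʳ-≤ 2 (*-monoˡ-≤ m (+-monoˡ-≤ s (≤-trans 1≤m (m≤m+n m _)))) ⟩
    2 * ((s + s) * m)  ≡⟨ solve 1 (λ m → con 2 :* ((con 4 :* m :+ con 4 :* m) :* m) := (con 4 :* m) :* (con 4 :* m)) refl m ⟩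
    s * s              ∎
    where open ℕ-Solver

theorem2p11 : ∀ (m : ℕ) → ∃ λ (N : ℕ) → ∀ (n : ℕ) → n ≥ N → C₃≤root n TCe (suc m)
-- Above this threshold the integer t-th root `b` of `n` is at least `2 + c`, so the factor `c` in
-- the alphabet size costs at most one more `suc b`.
theorem2p11 m = (2 + c) ^ t , λ n n≥N →
  let b , 2+c≤b , bᵗ≤n , n<kᵗ = root t (2 + c) n n≥N
  in bound b n 2+c≤b bᵗ≤n n<kᵗ
  where
  -- Merges the exponent of `M` in the number of colours with the root `suc m` to be beaten.
  m′ = length indices * suc m
  s  = 4 * m′
  t  = s * s
  c  = suc t ^ s
  4<m′ : 4 < m′
  4<m′ = ≤-trans 4<length-indices (m≤m*n (length indices) (suc m))
  16<s : 16 < s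
  16<s = *-monoʳ-< 4 4<m′
  1≤s : 1 ≤ s
  1≤s = ≤-trans (s≤s z≤n) 16<s
  instance
    s≢0 : NonZero s
    s≢0 = >-nonZero 1≤s
    t≢0 : NonZero t
    t≢0 = m*n≢0 s s
    c≢0 : NonZero c
    c≢0 = m^n≢0 (suc t) s
  bound : ∀ b n → 2 + c ≤ b → b ^ t ≤ n → n < suc b ^ t → C₃≤root n TCe (suc m)
  bound b n 2+c≤b bᵗ≤n n<kᵗ = M ^ length indices , colours≤n , localColouring
    where
    -- `suc b ^ s` bounds the coefficients of the polynomials as well as the packed restrictions;
    -- `c` accounts for evaluation at points below `t`.
    M = suc b ^ s * c
    c≤M : c ≤ M
    c≤M = m≤n*m c (suc b ^ s) {{m^n≢0 (suc b) s}}
    kˢ≤M : suc b ^ s ≤ M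
    kˢ≤M = m≤m*n (suc b ^ s) c
    base≤power : ∀ x → suc x ≤ suc x ^ s
    base≤power x = ≤-trans (≤-reflexive (sym (^-identityʳ (suc x)))) (^-monoʳ-≤ (suc x) 1≤s)
    t≤M : t ≤ M
    t≤M = ≤-trans (n≤1+n t) (≤-trans (base≤power t) c≤M)
    colours≤n : (M ^ length indices) ^ suc m ≤ n
    colours≤n = ≤-trans (≤-reflexive (^-*-assoc M (length indices) (suc m)))
      (few-colours m′ b n (≤-trans (s≤s z≤n) 4<m′) (≤-trans (m≤m+n 2 c) 2+c≤b)
        (m≤n⇒m≤1+n (≤-trans (m≤n+m c 2) 2+c≤b)) bᵗ≤n)
    code : Code (Fin n) t s (suc b) M
    code = digitCode s s (suc b) (<⇒≤ n<kᵗ)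
    open Colouring code (*-monoˡ-< s 16<s) t≤M (≤-trans (base≤power b) kˢ≤M) kˢ≤M (s≤s z≤n)
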